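{- Let $q=2^r$ with $r\ge 3$. Let $f\in\mathbb F_q[X,Y]$ be a local permutation polynomial whose permutation polynomial tuple consists of the $q$ elements of the group $G_2=\{b^ja^i:0\le j\le \frac q2-1,\ 0\le i\le 1\}$ (in some order), where $a$ and $b$ are as defined below. Then $f$ has a companion.
   Context: The elements of $\mathbb F_q$ are enumerated as $\mathbb F_q=\{c_0,\dots,c_{q-1}\}$; $\mathfrak S_q$ is the symmetric group of permutations of $\mathbb F_q$, composed right to left, written in cycle notation. $a=(c_0,c_1)(c_2,c_3)\cdots(c_{q-2},c_{q-1})$ and $b=(c_{\frac q2-2},c_{\frac q2-4},\dots,c_2,c_0,c_{\frac q2},c_{\frac q2+2},\dots,c_{q-4},c_{q-2})\,(c_1,c_3,\dots,c_{\frac q2-1},c_{q-1},c_{q-3},\dots,c_{\frac q2+1})$. ($G_2$ is a subgroup of $\mathfrak S_q$ of order $q$ whose non-identity elements have no fixed points.) Every function $\mathbb F_q^2\to\mathbb F_q$ is identified with the unique polynomial in $\mathbb F_q[X,Y]$ of degree $<q$ in each variable representing it. $f$ is a local permutation polynomial (LPP) if $x\mapsto f(x,y_0)$ and $y\mapsto f(x_0,y)$ are permutations of $\mathbb F_q$ for all $x_0,y_0$. A permutation polynomial tuple is $(\beta_0,\dots,\beta_{q-1})\in\mathfrak S_q^q$ such that $\beta_i^{ -1}\beta_j$ has no fixed point whenever $i\ne j$; LPPs $f$ correspond bijectively to such tuples via $f(x,\beta_i(x))=c_i$ for all $x$ and all $i$. Two LPPs $f,g$ are orthogonal (companions) if for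 every $(u,v)\in\mathbb F_q^2$ the system $f(X,Y)=u$, $g(X,Y)=v$ has exactly one solution in $\mathbb F_q^2$; a companion of $f$ is an LPP orthogonal to $f$. -}

module Defs where

open import Algebra.Apartness.Bundles using (HeytingField; module HeytingCommutativeRing)
open import Algebra.Bundles using (CommutativeRing; module Semiring)
import Algebra.Definitions.RawSemiring as RawSemiringDefs
open import Data.Fin.Base using (Fin; toℕ)
open import Data.Fin.Permutation using (Permutation′; transpose)
  renaming (id to idₚ)
open import Data.List.Base using (List; []; _∷_; _++_; map; foldr; upTo; downFrom)
open import Data.Nat.Base as ℕ using (ℕ; zero; suc; _<_; NonZero)
open import Data.Nat.DivMod using (_/_; _mod_)
open import Data.Nat.Properties using (m^n≢0)
open import Data.Product using (_×_; _,_; ∃; ∃₂; ∃!)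
open import Data.Product.Relation.Binary.Pointwise.NonDependent using (Pointwise)
open import Function.Bundles using (Inverse; _⇔_)
import Function.Construct.Composition as Composition
import Function.Construct.Identity as Identity
import Function.Construct.Symmetry as Symmetry
open import Function.Definitions using (Bijective)
open import Level using (Level; _⊔_)
open import Relation.Binary.Bundles using (Setoid)
open import Relation.Binary.PropositionalEquality as ≡ using (_≢_)
open import Relation.Nullary.Negation using (¬_)

private
  variable
    a ℓ c ℓ₁ ℓ₂ : Level
    n q : ℕ

-- Permutations of a setoid.  Composition is right to left: σ ∘ₛ τ applies τ first.

Sym : Setoid a ℓ → Set (a ⊔ ℓ)
Sym S = Inverse S S

module _ {S : Setoid a ℓ} where
  open Setoid S using (_≈_)

  infix 4 _≋_
  infixr 9 _∘ₛ_
  infixr 10 _^ₛ_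

  _≋_ : Sym S → Sym S → Set (a ⊔ ℓ)
  σ ≋ τ = ∀ x → Inverse.to σ x ≈ Inverse.to τ x

  _∘ₛ_ : Sym S → Sym S → Sym S
  σ ∘ₛ τ = Composition.inverse τ σ

  _⁻¹ₛ : Sym S → Sym S
  σ ⁻¹ₛ = Symmetry.inverse σ

  _^ₛ_ : Sym S → ℕ → Sym S
  σ ^ₛ zero  = Identity.inverse S
  σ ^ₛ suc k = σ ∘ₛ (σ ^ₛ k)

  FixedPointFree : Sym S → Set (a ⊔ ℓ)
  FixedPointFree σ = ∀ x → ¬ (Inverse.to σ x ≈ x)

-- For distinct entries this is the cycle x₁ ↦ x₂ ↦ … ↦ xₖ ↦ x₁, through
-- (x₁ x₂ … xₖ) = (x₁ x₂)(x₂ x₃)⋯(xₖ₋₁ xₖ), composed right to left.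

cycle : List (Fin n) → Permutation′ n
cycle []           = idₚ
cycle (x ∷ [])     = idₚ
cycle (x ∷ y ∷ ys) = transpose x y ∘ₛ cycle (y ∷ ys)

cycles : List (List (Fin n)) → Permutation′ n
cycles = foldr (λ xs σ → cycle xs ∘ₛ σ) idₚ

-- The permutations a and b, on the indices 0, …, q-1 of the field elements.
-- They are used only for q a multiple of 8: then the divisions are exact, every
-- number listed is < q, and reduction mod q merely embeds it in Fin q.

module _ (q : ℕ) .{{_ : NonZero q}} where

  indices : List ℕ → List (Fin q)
  indices = map (_mod q)

  aIndex : Permutation′ q
  aIndex = cycles (map (λ k → indices (2 ℕ.* k ∷ 2 ℕ.* k ℕ.+ 1 ∷ [])) (upTo (q / 2)))

  bIndex : Permutation′ q
  bIndex = cycles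
    ( indices (map (λ k → 2 ℕ.* k) (downFrom (q / 4))
               ++ map (λ k → q / 2 ℕ.+ 2 ℕ.* k) (upTo (q / 4)))
    ∷ indices (map (λ k → 2 ℕ.* k ℕ.+ 1) (upTo (q / 4))
               ++ map (λ k → q / 2 ℕ.+ 2 ℕ.* k ℕ.+ 1) (downFrom (q / 4)))
    ∷ [])

-- A field is a HeytingField.  In the presence of a finite enumeration the
-- apartness x # y (invertibility of x - y) is decidable and means ¬ (x ≈ y).

module _ (F : HeytingField c ℓ₁ ℓ₂) where
  open CommutativeRing
    (HeytingCommutativeRing.commutativeRing (HeytingField.heytingCommutativeRing F))
    using (Carrier; _≈_; _*_; setoid; semiring)
  open RawSemiringDefs (Semiring.rawSemiring semiring) using (_^_; sum)

  Enumeration : ℕ → Set (c ⊔ ℓ₁)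
  Enumeration q = Inverse (≡.setoid (Fin q)) setoid

  -- p i j is the coefficient of XⁱYʲ, so both partial degrees are < q.
  Polynomial : ℕ → Set c
  Polynomial q = Fin q → Fin q → Carrier

  eval : Polynomial q → Carrier → Carrier → Carrier
  eval p x y = sum λ i → sum λ j → p i j * (x ^ toℕ i * y ^ toℕ j)

  IsLPP : Polynomial q → Set (c ⊔ ℓ₁)
  IsLPP f = (∀ y₀ → Bijective _≈_ _≈_ (λ x → eval f x y₀))
          × (∀ x₀ → Bijective _≈_ _≈_ (λ y → eval f x₀ y))

  Orthogonal : Polynomial q → Polynomial q → Set (c ⊔ ℓ₁)
  Orthogonal f g = ∀ u v →
    ∃! (Pointwise _≈_ _≈_) λ (x , y) → eval f x y ≈ u × eval g x y ≈ v

  HasCompanion : Polynomial q → Set (c ⊔ ℓ₁)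
  HasCompanion {q} f = ∃ λ (g : Polynomial q) → IsLPP g × Orthogonal f g

  IsPermutationTuple : (Fin q → Sym setoid) → Set (c ⊔ ℓ₁)
  IsPermutationTuple β = ∀ {i j} → i ≢ j → FixedPointFree (β i ⁻¹ₛ ∘ₛ β j)

  record IsTupleOf (enum : Enumeration q) (f : Polynomial q)
                   (β : Fin q → Sym setoid) : Set (c ⊔ ℓ₁) where
    field
      isPermutationTuple : IsPermutationTuple β
      graph              : ∀ i x → eval f x (Inverse.to (β i) x) ≈ Inverse.to enum i

  -- The set of entries of the tuple β is the set P of permutations.
  ConsistsOf : (Fin q → Sym setoid) → (Sym setoid → Set (c ⊔ ℓ₁)) → Set (c ⊔ ℓ₁)
  ConsistsOf β P = ∀ σ → (∃ λ i → σ ≋ β i) ⇔ P σ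

  -- With c_i = to enum i, the permutation c_i ↦ c_{π i} of the field.
  onField : Enumeration q → Permutation′ q → Sym setoid
  onField enum π = Composition.inverse (Symmetry.inverse enum) (Composition.inverse π enum)

  module _ (r : ℕ) (enum : Enumeration (2 ℕ.^ r)) where

    aₚ bₚ : Sym setoid
    aₚ = onField enum (aIndex (2 ℕ.^ r) {{m^n≢0 2 r}})
    bₚ = onField enum (bIndex (2 ℕ.^ r) {{m^n≢0 2 r}})

    InG₂ : Sym setoid → Set (c ⊔ ℓ₁)
    InG₂ σ = ∃₂ λ j i → j < 2 ℕ.^ r / 2 × i < 2 × σ ≋ (bₚ ^ₛ j) ∘ₛ (aₚ ^ₛ i)

-- The tuple of f is a regular group G of permutations.  If θ : G → G and z ↦ z θ(z) are both
-- bijections, then g(x,y) = θ(β)⁻¹(x), where β is the element of G with β(x) = y, is a companion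
-- of f: the system f = u, g = v forces β = βᵤ and x = θ(β)(v), y = β(x), while g is injective
-- in y because θ is, and in x because g(x,y) = (β θ(β))⁻¹(y).
-- G is dihedral: a² = 1 and b a b = a, and bᴺ = 1 follows from regularity (N = q/2).
-- With N = 2M and 0 ≤ k < M, 0 ≤ h, e ≤ 1, such a θ is
--   b^(Mh+k) ↦ b^k a^h,   b^(Mh+k) a ↦ b^(-1-k) a^(1-h),
-- because z = b^(Mh+k) a^e then has z θ(z) = b^(Mh+2k+e) a^h.

module Submission where

open import Defs
open import Algebra.Apartness.Bundles using (HeytingField; module HeytingCommutativeRing)
open import Algebra.Bundles using (CommutativeRing; module Semiring)
import Algebra.Definitions.RawSemiring as RawSemiringDefs
import Algebra.Properties.CommutativeSemigroup as CommutativeSemigroupProperties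
import Algebra.Properties.Semiring.Exp as Exp
import Algebra.Properties.Semiring.Sum as Sum
open import Data.Fin.Base using (Fin; zero; suc; toℕ; fromℕ<; punchOut; combine; remQuot; opposite)
open import Data.Fin.Patterns using (0F; 1F)
open import Data.Fin.Permutation using (Permutation′; transpose)
open import Data.Fin.Properties as Fin
  using (any?; punchOut-injective; injective⇒≤; toℕ<n; toℕ-fromℕ<; toℕ-injective; fromℕ<-injective;
         toℕ-combine; combine-injective; combine-remQuot; opposite-prop; opposite-involutive)
open import Data.List.Base using (List; []; _∷_; _++_; map; upTo; downFrom; applyUpTo)
open import Data.List.Membership.Propositional using (_∈_; _∉_)
open import Data.List.Membership.Propositional.Properties using (∈-map⁻; ∈-upTo⁺)
open import Data.List.Properties using (map-++; map-cong; map-∘)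
open import Data.List.Relation.Unary.All as All using (All; []; _∷_)
import Data.List.Relation.Unary.All.Properties as All
open import Data.List.Relation.Unary.AllPairs using ([]; _∷_)
open import Data.List.Relation.Unary.Any using (here; there)
open import Data.List.Relation.Unary.Unique.Propositional using (Unique)
import Data.List.Relation.Unary.Unique.Propositional.Properties as Unique
open import Data.Maybe.Base using (nothing)
open import Data.Nat.Base using (ℕ; zero; suc; _≤_)
import Data.Nat.Properties as ℕ
open import Data.Product using (_×_; _,_; ∃; ∃₂; proj₁; proj₂)
open import Data.Sum using (_⊎_; inj₁; inj₂)
open import Function using (_∘_; id; Inverse; Injective; Bijective; Congruent)
open import Function.Bundles using (module Equivalence; module Injection)
open import Function.Properties.Inverse using (Inverse⇒Injection)
import Relation.Binary.Reasoning.Setoid as SetoidReasoning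
open import Relation.Binary.PropositionalEquality as ≡ using (_≡_; _≢_)
open import Relation.Nullary using (¬_; Dec; yes; no; contradiction)
open import Relation.Nullary.Decidable using (map′)
open import Tactic.RingSolver.Core.AlmostCommutativeRing using (fromCommutativeRing)
import Tactic.RingSolver.NonReflective as RingSolver

open Inverse using (to; from)

-- Interpolation and companions over a finite field

-- The shape of θ answers an obstruction. The powers of b alone form a cyclic group of even order,
-- which admits no bijection θ with z θ(z) bijective: the product of all its elements, the element
-- of order 2, would have to equal its own square. So θ must mix the two cosets. In the coordinates
-- (h, k, e), θ lets e choose the half of the exponent range and h the coset; in z θ(z) the doubled
-- exponent 2k leaves room for e as its lowest binary digit, and since h has become the coset, the
-- shift by Mh is constant on each coset and causes no collision. The relations a² = 1 and bab = a
-- are checked pointwise on the cycles. The order of b is deduced from regularity, which avoids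
-- following a whole cycle round; regularity comes from counting, since q entries that pairwise
-- agree nowhere must exhaust the 2N = q expressions bˢaᵉ. The group theory takes place on indices,
-- where equality is propositional; interpolation turns the resulting table of values into a
-- polynomial.

injective⇒strictlySurjective : ∀ {m n} {f : Fin m → Fin n} → n ≤ m → Injective _≡_ _≡_ f →
                               ∀ y → ∃ λ x → f x ≡ y
injective⇒strictlySurjective {m} {suc n} {f} n≤m inj y with any? (λ x → f x Fin.≟ y)
... | yes hit = hit
-- A missed value can be punched out of the codomain, which leaves an injection into a type with one
-- element fewer.
... | no miss = contradiction (ℕ.≤-trans n≤m (injective⇒≤ avoid-injective)) ℕ.1+n≰n
  where
  y≢f : ∀ x → y ≢ f x
  y≢f x eq = miss (x , ≡.sym eq)

  avoid-injective : Injective _≡_ _≡_ (λ x → punchOut (y≢f x))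
  avoid-injective eq = inj (punchOut-injective (y≢f _) (y≢f _) eq)

module FiniteField {c ℓ₁ ℓ₂} (F : HeytingField c ℓ₁ ℓ₂) where

  commutativeRing : CommutativeRing c ℓ₁
  commutativeRing = HeytingCommutativeRing.commutativeRing (HeytingField.heytingCommutativeRing F)

  open CommutativeRing commutativeRing hiding (zero)
  open RawSemiringDefs (Semiring.rawSemiring semiring) using (_^_; sum)
  open Sum semiring using (sum-cong-≋; *-distribˡ-sum; *-distribʳ-sum)
  open Exp semiring using (^-congˡ)
  open SetoidReasoning setoid

  evalUnivariate : ∀ {n} → (Fin n → Carrier) → Carrier → Carrier
  evalUnivariate p x = sum λ i → p i * x ^ toℕ i

  horner : ∀ {n} (p : Fin (suc n) → Carrier) x →
           evalUnivariate p x ≈ p zero + x * evalUnivariate (p ∘ suc) x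
  horner {n} p x = +-cong (*-identityʳ _) (trans
    (sum-cong-≋ {n} λ i → x∙yz≈y∙xz (p (suc i)) x (x ^ toℕ i))
    (sym (*-distribˡ-sum x (λ i → p (suc i) * x ^ toℕ i))))
    where open CommutativeSemigroupProperties *-commutativeSemigroup

  -- Splitting r as r₀ + X r′ gives d + (X - c) r = (d - c r₀) + X (r₀ + (X - c) r′), an instance of
  -- the same shape with one coefficient fewer. The result has just one more coefficient than r,
  -- which keeps the degree bound of the interpolation exact.
  linear-combination : ∀ {n} (d c : Carrier) (r : Fin n → Carrier) →
    ∃ λ (p : Fin (suc n) → Carrier) → ∀ x → evalUnivariate p x ≈ d + (x - c) * evalUnivariate r x
  linear-combination {zero} d c r = (λ _ → d) , λ x → +-cong (*-identityʳ d) (sym (zeroʳ _))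
  linear-combination {suc n} d c r with linear-combination (r zero) c (r ∘ suc)
  ... | p , eq = p′ , λ x → let R = evalUnivariate (r ∘ suc) x in begin
    evalUnivariate p′ x                              ≈⟨ horner p′ x ⟩
    d + - c * r zero + x * evalUnivariate p x        ≈⟨ +-congˡ (*-congˡ (eq x)) ⟩
    d + - c * r zero + x * (r zero + (x - c) * R)    ≈⟨ solve 5 (λ d c x r R →
      (d ⊕ c ⊗ r ⊕ x ⊗ (r ⊕ (x ⊕ c) ⊗ R)) ⊜ (d ⊕ (x ⊕ c) ⊗ (r ⊕ x ⊗ R))) refl d (- c) x (r zero) R ⟩
    d + (x - c) * (r zero + x * R)                   ≈⟨ +-congˡ (*-congˡ (horner r x)) ⟨
    d + (x - c) * evalUnivariate r x                 ∎
    where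
    open RingSolver (fromCommutativeRing commutativeRing (λ _ → nothing))
      using (solve; _⊕_; _⊗_; _⊜_)
    p′ : Fin (suc (suc n)) → Carrier
    p′ zero    = d + - c * r zero
    p′ (suc i) = p i

  eval-nested : ∀ {n} (p : Polynomial F n) x y →
                eval F p x y ≈ evalUnivariate (λ i → evalUnivariate (p i) y) x
  eval-nested {n} p x y = sum-cong-≋ {n} λ i → trans
    (sum-cong-≋ {n} λ j → x∙yz≈xz∙y (p i j) (x ^ toℕ i) (y ^ toℕ j))
    (sym (*-distribʳ-sum (x ^ toℕ i) (λ j → p i j * y ^ toℕ j)))
    where open CommutativeSemigroupProperties *-commutativeSemigroup

  eval-cong : ∀ {n} (p : Polynomial F n) {x x′ y y′} → x ≈ x′ → y ≈ y′ → eval F p x y ≈ eval F p x′ y′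
  eval-cong {n} p x≈x′ y≈y′ = sum-cong-≋ {n} λ i → sum-cong-≋ {n} λ j →
    *-congˡ (*-cong (^-congˡ (toℕ i) x≈x′) (^-congˡ (toℕ j) y≈y′))

  evalUnivariate-cong : ∀ {n} {p p′ : Fin n → Carrier} → (∀ i → p i ≈ p′ i) →
                        ∀ x → evalUnivariate p x ≈ evalUnivariate p′ x
  evalUnivariate-cong {n} eq x = sum-cong-≋ {n} λ i → *-congʳ (eq i)

  module _ {q} (enum : Enumeration F q) where

    to-injective : Injective _≡_ _≈_ (to enum)
    to-injective {i} {j} eq = ≡.trans (≡.sym (Inverse.strictlyInverseʳ enum i))
      (≡.trans (Inverse.from-cong enum eq) (Inverse.strictlyInverseʳ enum j))

    to-from : ∀ x → to enum (from enum x) ≈ x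
    to-from = Inverse.strictlyInverseˡ enum

    from-to : ∀ i → from enum (to enum i) ≡ i
    from-to = Inverse.strictlyInverseʳ enum

    _≈?_ : ∀ x y → Dec (x ≈ y)
    x ≈? y = map′ (λ eq → trans (sym (to-from x)) (trans (Inverse.to-cong enum eq) (to-from y)))
                  (Inverse.from-cong enum) (from enum x Fin.≟ from enum y)

    -- Apartness does not follow directly from `¬ x ≈ y`, so the inverse is searched for among the
    -- finitely many elements. A failed search refutes `x # y`, and tightness then yields `x ≈ y`.
    inverse-of-difference : ∀ {x y} → ¬ x ≈ y → ∃ λ z → (x - y) * z ≈ 1#
    inverse-of-difference {x} {y} x≉y with any? (λ i → ((x - y) * to enum i) ≈? 1#)
    ... | yes (i , eq) = to enum i , eq
    ... | no  ¬inv     = contradiction (proj₁ (HeytingField.tight F x y) λ x#y →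
      let (z , _ , eq) = HeytingField.#⇒invertible F x#y in
      ¬inv (from enum z , trans (*-congˡ (to-from z)) eq)) x≉y

    -- Newton's scheme: p = h₀ + (X - c₀) r, where r interpolates the divided differences `slope` at
    -- the remaining nodes.
    interpolate : ∀ {n} (c h : Fin n → Carrier) → (∀ {i j} → i ≢ j → ¬ c i ≈ c j) →
      ∃ λ (p : Fin n → Carrier) → ∀ i → evalUnivariate p (c i) ≈ h i
    interpolate {zero}  c h distinct = h , λ ()
    interpolate {suc n} c h distinct = p , λ where
        zero → begin
          evalUnivariate p (c zero)                       ≈⟨ p≈ (c zero) ⟩
          h zero + (c zero - c zero) * evalUnivariate r _ ≈⟨ +-congˡ (trans (*-congʳ (-‿inverseʳ (c zero))) (zeroˡ _)) ⟩
          h zero + 0#                                     ≈⟨ +-identityʳ (h zero) ⟩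
          h zero                                          ∎
        (suc i) → begin
          evalUnivariate p (c (suc i))                                ≈⟨ p≈ (c (suc i)) ⟩
          h zero + (c (suc i) - c zero) * evalUnivariate r (c (suc i)) ≈⟨ +-congˡ (*-congˡ (r≈ i)) ⟩
          h zero + (c (suc i) - c zero) * slope i                     ≈⟨ +-congˡ (sym (*-assoc _ _ _)) ⟩
          h zero + (c (suc i) - c zero) * inv i * (h (suc i) - h zero) ≈⟨ +-congˡ (trans (*-congʳ (inv-inverse i)) (*-identityˡ _)) ⟩
          h zero + (h (suc i) - h zero)                               ≈⟨ +-comm _ _ ⟩
          h (suc i) - h zero + h zero                                 ≈⟨ +-assoc _ _ _ ⟩
          h (suc i) + (- h zero + h zero)                             ≈⟨ +-congˡ (-‿inverseˡ (h zero)) ⟩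
          h (suc i) + 0#                                              ≈⟨ +-identityʳ _ ⟩
          h (suc i)                                                   ∎
      where
      inverse : ∀ i → ∃ λ z → (c (suc i) - c zero) * z ≈ 1#
      inverse i = inverse-of-difference (distinct (λ ()))
      inv : Fin n → Carrier
      inv i = proj₁ (inverse i)
      inv-inverse : ∀ i → (c (suc i) - c zero) * inv i ≈ 1#
      inv-inverse i = proj₂ (inverse i)
      slope : Fin n → Carrier
      slope i = inv i * (h (suc i) - h zero)
      quotient = interpolate (c ∘ suc) slope (λ i≢j → distinct (i≢j ∘ Fin.suc-injective))
      r  = proj₁ quotient
      r≈ = proj₂ quotient
      extension = linear-combination (h zero) (c zero) r
      p  = proj₁ extension
      p≈ = proj₂ extension

    -- For each fixed `j` the values are interpolated in the first variable; each coefficient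
    -- obtained is then a function of `j`, interpolated in the second.
    interpolate₂ : (h : Fin q → Fin q → Carrier) →
      ∃ λ (p : Polynomial F q) → ∀ i j → eval F p (to enum i) (to enum j) ≈ h i j
    interpolate₂ h = p , λ i j → begin
      eval F p (to enum i) (to enum j)                                       ≈⟨ eval-nested p _ _ ⟩
      evalUnivariate (λ k → evalUnivariate (p k) (to enum j)) (to enum i)    ≈⟨ evalUnivariate-cong (λ k → p≈ k j) (to enum i) ⟩
      evalUnivariate (row j) (to enum i)                                     ≈⟨ row≈ j i ⟩
      h i j                                                                  ∎
      where
      distinct : ∀ {i j} → i ≢ j → ¬ to enum i ≈ to enum j
      distinct i≢j eq = i≢j (to-injective eq)

      row : Fin q → Fin q → Carrier
      row j = proj₁ (interpolate (to enum) (λ i → h i j) distinct)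
      row≈ : ∀ j i → evalUnivariate (row j) (to enum i) ≈ h i j
      row≈ j = proj₂ (interpolate (to enum) (λ i → h i j) distinct)

      p : Polynomial F q
      p k = proj₁ (interpolate (to enum) (λ j → row j k) distinct)
      p≈ : ∀ k j → evalUnivariate (p k) (to enum j) ≈ row j k
      p≈ k = proj₂ (interpolate (to enum) (λ j → row j k) distinct)

    bijective : (φ : Carrier → Carrier) → Congruent _≈_ _≈_ φ → (φ̂ : Fin q → Fin q) →
                (∀ i → φ (to enum i) ≈ to enum (φ̂ i)) → Injective _≡_ _≡_ φ̂ → Bijective _≈_ _≈_ φ
    bijective φ φ-cong φ̂ φ≈ φ̂-inj = injective , surjective
      where
      φ≈′ : ∀ x → φ x ≈ to enum (φ̂ (from enum x))
      φ≈′ x = trans (φ-cong (sym (to-from x))) (φ≈ _)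

      injective : Injective _≈_ _≈_ φ
      injective {x} {y} eq = trans (sym (to-from x)) (trans (Inverse.to-cong enum (φ̂-inj (to-injective
        (trans (sym (φ≈′ x)) (trans eq (φ≈′ y)))))) (to-from y))

      surjective : ∀ y → ∃ λ x → ∀ {z} → z ≈ x → φ z ≈ y
      surjective y with i , eq ← injective⇒strictlySurjective ℕ.≤-refl φ̂-inj (from enum y) =
        to enum i , λ z≈ → trans (φ-cong z≈) (trans (φ≈ i) (trans (Inverse.to-cong enum eq) (to-from y)))

    ^ₛ-onField : ∀ (π : Permutation′ q) k i →
                 to (onField F enum π ^ₛ k) (to enum i) ≈ to enum (to (π ^ₛ k) i)
    ^ₛ-onField π zero    i = refl
    ^ₛ-onField π (suc k) i = Inverse.to-cong enum (≡.cong (to π)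
      (≡.trans (Inverse.from-cong enum (^ₛ-onField π k i)) (from-to _)))

    ^ₛ∘^ₛ-onField : ∀ (π ρ : Permutation′ q) k l i →
      to ((onField F enum π ^ₛ k) ∘ₛ (onField F enum ρ ^ₛ l)) (to enum i) ≈
      to enum (to ((π ^ₛ k) ∘ₛ (ρ ^ₛ l)) i)
    ^ₛ∘^ₛ-onField π ρ k l i = trans (Inverse.to-cong (onField F enum π ^ₛ k) (^ₛ-onField ρ l i))
                                    (^ₛ-onField π k _)

    -- A point where `β i` and `β j` agree is a fixed point of `β i ⁻¹ₛ ∘ₛ β j`.
    tuple-injective : (β : Fin q → Sym setoid) → IsPermutationTuple F β →
                      ∀ {i j} x → to (β i) x ≈ to (β j) x → i ≡ j
    tuple-injective β fpf {i} {j} x eq with i Fin.≟ j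
    ... | yes i≡j = i≡j
    ... | no  i≢j = contradiction (Inverse.inverseʳ (β i) (sym eq)) (fpf i≢j x)

    -- B i and L i are βᵢ and θ(βᵢ), acting on the indices of the field elements.
    companion : (f : Polynomial F q) → IsLPP F f →
      (B : Fin q → Fin q → Fin q) (L : Fin q → Permutation′ q) →
      (∀ i x → eval F f (to enum x) (to enum (B i x)) ≈ to enum i) →
      (∀ w {i j} → to (L i) w ≡ to (L j) w → i ≡ j) →
      (∀ w {i j} → B i (to (L i) w) ≡ B j (to (L j) w) → i ≡ j) →
      HasCompanion F f
    companion f (f-x , f-y) B L graph L-inj BL-inj = g , (g-x , g-y) , orthogonal
      where
      f̂ ĝ : Fin q → Fin q → Fin q
      f̂ x y = from enum (eval F f (to enum x) (to enum y))
      ĝ x y = from (L (f̂ x y)) x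

      f≈ : ∀ x y → eval F f (to enum x) (to enum y) ≈ to enum (f̂ x y)
      f≈ x y = sym (to-from _)

      f̂-B : ∀ i x → f̂ x (B i x) ≡ i
      f̂-B i x = ≡.trans (Inverse.from-cong enum (graph i x)) (from-to i)

      f̂-injˡ : ∀ {x x′} y → f̂ x y ≡ f̂ x′ y → x ≡ x′
      f̂-injˡ {x} {x′} y eq = to-injective (proj₁ (f-x (to enum y))
        (trans (f≈ x y) (trans (Inverse.to-cong enum eq) (sym (f≈ x′ y)))))

      f̂-injʳ : ∀ x {y y′} → f̂ x y ≡ f̂ x y′ → y ≡ y′
      f̂-injʳ x {y} {y′} eq = to-injective (proj₁ (f-y (to enum x))
        (trans (f≈ x y) (trans (Inverse.to-cong enum eq) (sym (f≈ x y′)))))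

      B-f̂ : ∀ x y → B (f̂ x y) x ≡ y
      B-f̂ x y = f̂-injʳ x (f̂-B (f̂ x y) x)

      L-ĝ : ∀ x y → to (L (f̂ x y)) (ĝ x y) ≡ x
      L-ĝ x y = Inverse.strictlyInverseˡ (L (f̂ x y)) x

      ĝ-injʳ : ∀ x {y y′} → ĝ x y ≡ ĝ x y′ → y ≡ y′
      ĝ-injʳ x {y} {y′} eq = f̂-injʳ x (L-inj (ĝ x y) (≡.trans (L-ĝ x y)
        (≡.trans (≡.sym (L-ĝ x y′)) (≡.cong (to (L (f̂ x y′))) (≡.sym eq)))))

      BL-ĝ : ∀ x y → B (f̂ x y) (to (L (f̂ x y)) (ĝ x y)) ≡ y
      BL-ĝ x y = ≡.trans (≡.cong (B (f̂ x y)) (L-ĝ x y)) (B-f̂ x y)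

      -- Only `y` is shared here, so the common value is followed through θ(β) and then β, as far as
      -- `y`; this is where the products β θ(β) enter.
      ĝ-injˡ : ∀ {x x′} y → ĝ x y ≡ ĝ x′ y → x ≡ x′
      ĝ-injˡ {x} {x′} y eq = f̂-injˡ y (BL-inj (ĝ x y) (≡.trans (BL-ĝ x y)
        (≡.trans (≡.sym (BL-ĝ x′ y)) (≡.cong (B (f̂ x′ y) ∘ to (L (f̂ x′ y))) (≡.sym eq)))))

      g : Polynomial F q
      g = proj₁ (interpolate₂ (λ x y → to enum (ĝ x y)))
      g≈ : ∀ x y → eval F g (to enum x) (to enum y) ≈ to enum (ĝ x y)
      g≈ = proj₂ (interpolate₂ (λ x y → to enum (ĝ x y)))

      g-x : ∀ y → Bijective _≈_ _≈_ (λ x → eval F g x y)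
      g-x y = bijective _ (λ x≈ → eval-cong g x≈ refl) (λ x → ĝ x (from enum y))
        (λ x → trans (eval-cong g refl (sym (to-from y))) (g≈ x _)) (ĝ-injˡ _)

      g-y : ∀ x → Bijective _≈_ _≈_ (λ y → eval F g x y)
      g-y x = bijective _ (λ y≈ → eval-cong g refl y≈) (λ y → ĝ (from enum x) y)
        (λ y → trans (eval-cong g (sym (to-from x)) refl) (g≈ _ y)) (ĝ-injʳ _)

      ĝ-graph : ∀ i w → ĝ (to (L i) w) (B i (to (L i) w)) ≡ w
      ĝ-graph i w = ≡.trans (≡.cong (λ j → from (L j) (to (L i) w)) (f̂-B i _))
                            (Inverse.strictlyInverseʳ (L i) w)

      index : (p : Polynomial F q) (p̂ : Fin q → Fin q → Fin q) →
        (∀ x y → eval F p (to enum x) (to enum y) ≈ to enum (p̂ x y)) →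
        ∀ {x y u} → eval F p x y ≈ u → p̂ (from enum x) (from enum y) ≡ from enum u
      index p p̂ p≈ {x} {y} eq = to-injective (trans (sym (p≈ _ _))
        (trans (eval-cong p (to-from x) (to-from y)) (trans eq (sym (to-from _)))))

      orthogonal : Orthogonal F f g
      orthogonal u v = (to enum x , to enum y) ,
        (trans (graph i x) (to-from u) ,
         trans (g≈ x y) (trans (Inverse.to-cong enum (ĝ-graph i w)) (to-from v))) ,
        unique
        where
        i w x y : Fin q
        i = from enum u
        w = from enum v
        x = to (L i) w
        y = B i x

        unique : ∀ {z} → eval F f (proj₁ z) (proj₂ z) ≈ u × eval F g (proj₁ z) (proj₂ z) ≈ v →
                 to enum x ≈ proj₁ z × to enum y ≈ proj₂ z
        unique {x′ , y′} (fu , gv) = trans (Inverse.to-cong enum x≡) (to-from x′) ,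
                                     trans (Inverse.to-cong enum y≡) (to-from y′)
          where
          x̂ ŷ : Fin q
          x̂ = from enum x′
          ŷ = from enum y′
          f̂≡i : f̂ x̂ ŷ ≡ i
          f̂≡i = index f f̂ f≈ fu
          ĝ≡w : ĝ x̂ ŷ ≡ w
          ĝ≡w = index g ĝ g≈ gv
          x≡ : x ≡ x̂
          x≡ = ≡.trans (≡.cong₂ (λ j z → to (L j) z) (≡.sym f̂≡i) (≡.sym ĝ≡w)) (L-ĝ x̂ ŷ)
          y≡ : y ≡ ŷ
          y≡ = ≡.trans (≡.cong₂ B (≡.sym f̂≡i) x≡) (B-f̂ x̂ ŷ)

-- The action of the cycles on indices

open import Data.Nat.Base
open import Data.Nat.DivMod
  using (_/_; _%_; _mod_; m<n⇒m%n≡m; m%n<n; m≡m%n+[m/n]*n; m*n/n≡m)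
open import Data.Nat.Properties
open import Data.Nat.Solver using (module +-*-Solver)
open ≡

private
  variable
    A B : Set
    n : ℕ
    x y z : A
    xs ys : List A

transpose-matchˡ : (i j : Fin n) → to (transpose i j) i ≡ j
transpose-matchˡ i j with i Fin.≟ i
... | yes _  = refl
... | no i≢i = contradiction refl i≢i

transpose-matchʳ : (i j : Fin n) → to (transpose i j) j ≡ i
transpose-matchʳ i j with j Fin.≟ i
... | yes j≡i = j≡i
... | no _ with j Fin.≟ j
...   | yes _  = refl
...   | no j≢j = contradiction refl j≢j

transpose-mismatch : {i j k : Fin n} → k ≢ i → k ≢ j → to (transpose i j) k ≡ k
transpose-mismatch {i = i} {j} {k} k≢i k≢j with k Fin.≟ i
... | yes k≡i = contradiction k≡i k≢i
... | no _ with k Fin.≟ j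
...   | yes k≡j = contradiction k≡j k≢j
...   | no _    = refl

-- Evaluating a cycle through the entry that comes next

data Adjacent {A : Set} (x y : A) : List A → Set where
  here  : ∀ {xs} → Adjacent x y (x ∷ y ∷ xs)
  there : ∀ {z xs} → Adjacent x y xs → Adjacent x y (z ∷ xs)

data Last {A : Set} (x : A) : List A → Set where
  here  : Last x (x ∷ [])
  there : ∀ {z xs} → Last x xs → Last x (z ∷ xs)

-- A relation between entries and not positions: it passes through `map` and `++`, so the two halves
-- of each cycle of b can be treated without index arithmetic.
data CyclicallyAdjacent {A : Set} (x y : A) : List A → Set where
  adjacent : ∀ {xs} → Adjacent x y xs → CyclicallyAdjacent x y xs
  wrap     : ∀ {xs} → Last x (y ∷ xs) → CyclicallyAdjacent x y (y ∷ xs)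

adjacent-map : (f : A → B) → Adjacent x y xs → Adjacent (f x) (f y) (map f xs)
adjacent-map f here      = here
adjacent-map f (there p) = there (adjacent-map f p)

last-map : (f : A → B) → Last x xs → Last (f x) (map f xs)
last-map f here      = here
last-map f (there p) = there (last-map f p)

cyclicallyAdjacent-map : (f : A → B) → CyclicallyAdjacent x y xs →
                         CyclicallyAdjacent (f x) (f y) (map f xs)
cyclicallyAdjacent-map f (adjacent p) = adjacent (adjacent-map f p)
cyclicallyAdjacent-map f (wrap p)     = wrap (last-map f p)

adjacent-++ˡ : Adjacent x y xs → Adjacent x y (xs ++ ys)
adjacent-++ˡ here      = here
adjacent-++ˡ (there p) = there (adjacent-++ˡ p)

adjacent-++ʳ : ∀ (xs : List A) → Adjacent x y ys → Adjacent x y (xs ++ ys)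
adjacent-++ʳ []       p = p
adjacent-++ʳ (x ∷ xs) p = there (adjacent-++ʳ xs p)

adjacent-join : Last x xs → Adjacent x y (xs ++ y ∷ ys)
adjacent-join here      = here
adjacent-join (there p) = there (adjacent-join p)

last-++ʳ : ∀ (xs : List A) → Last x ys → Last x (xs ++ ys)
last-++ʳ []       p = p
last-++ʳ (x ∷ xs) p = there (last-++ʳ xs p)

adjacent⇒∈ : Adjacent x y xs → y ∈ xs
adjacent⇒∈ here      = there (here refl)
adjacent⇒∈ (there p) = there (adjacent⇒∈ p)

adjacent⇒∈ˡ : Adjacent x y xs → x ∈ xs
adjacent⇒∈ˡ here      = here refl
adjacent⇒∈ˡ (there p) = there (adjacent⇒∈ˡ p)

last⇒∈ : Last x xs → x ∈ xs
last⇒∈ here      = here refl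
last⇒∈ (there p) = there (last⇒∈ p)

adjacent-tail : Adjacent x y (z ∷ xs) → y ∈ xs
adjacent-tail here      = here refl
adjacent-tail (there p) = adjacent⇒∈ p

cycle-outside : {x : Fin n} (xs : List (Fin n)) → x ∉ xs → to (cycle xs) x ≡ x
cycle-outside []           x∉ = refl
cycle-outside (y ∷ [])     x∉ = refl
cycle-outside (y ∷ z ∷ zs) x∉ = trans
  (cong (to (transpose y z)) (cycle-outside (z ∷ zs) (x∉ ∘ there)))
  (transpose-mismatch (λ eq → x∉ (here eq)) (λ eq → x∉ (there (here eq))))

-- If `x` heads the list, the tail fixes it and the outer transposition moves it to `y`. Otherwise
-- the tail already gives `y`, which lies behind the first two entries and so, by uniqueness,
-- escapes the outer transposition.
cycle-adjacent : {x y : Fin n} {xs : List (Fin n)} → Unique xs → Adjacent x y xs →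
                 to (cycle xs) x ≡ y
cycle-adjacent {x = x} {y} {_ ∷ _ ∷ zs} u here = trans
  (cong (to (transpose x y)) (cycle-outside (y ∷ zs) (Unique.Unique[x∷xs]⇒x∉xs u)))
  (transpose-matchˡ x y)
cycle-adjacent {xs = w ∷ z ∷ zs} u@(_ ∷ u′@(z≢ ∷ _)) (there p) = trans
  (cong (to (transpose w z)) (cycle-adjacent u′ p))
  (transpose-mismatch
    (λ { refl → Unique.Unique[x∷xs]⇒x∉xs u (there (adjacent-tail p)) })
    (λ { refl → Unique.Unique[x∷xs]⇒x∉xs u′ (adjacent-tail p) }))

-- The tail carries its last entry to its own head, which the outer transposition exchanges with
-- `y`.
cycle-last : {x y : Fin n} {xs : List (Fin n)} → Last x (y ∷ xs) → to (cycle (y ∷ xs)) x ≡ y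
cycle-last {xs = []}     here      = refl
cycle-last {y = y} {xs = z ∷ zs} (there p) =
  trans (cong (to (transpose y z)) (cycle-last p)) (transpose-matchʳ y z)

cycle-cyclicallyAdjacent : {x y : Fin n} {xs : List (Fin n)} → Unique xs →
                           CyclicallyAdjacent x y xs → to (cycle xs) x ≡ y
cycle-cyclicallyAdjacent u (adjacent p) = cycle-adjacent u p
cycle-cyclicallyAdjacent u (wrap p)     = cycle-last p

adjacent-applyUpTo : ∀ (f : ℕ → A) {m k} → suc k < m → Adjacent (f k) (f (suc k)) (applyUpTo f m)
adjacent-applyUpTo f {suc (suc m)} {zero}  k<m       = here
adjacent-applyUpTo f {suc m}       {suc k} (s≤s k<m) = there (adjacent-applyUpTo (f ∘ suc) k<m)

adjacent-upTo : ∀ {m k} → suc k < m → Adjacent k (suc k) (upTo m)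
adjacent-upTo = adjacent-applyUpTo id

adjacent-downFrom : ∀ m {k} → suc k < m → Adjacent (suc k) k (downFrom m)
adjacent-downFrom (suc m) {k} k<m with suc k ≟ m
... | yes refl = here
... | no  k≢m  = there (adjacent-downFrom m (≤∧≢⇒< (s≤s⁻¹ k<m) k≢m))

last-applyUpTo : ∀ (f : ℕ → A) m → Last (f m) (applyUpTo f (suc m))
last-applyUpTo f zero    = here
last-applyUpTo f (suc m) = there (last-applyUpTo (f ∘ suc) m)

last-downFrom : ∀ m → Last 0 (downFrom (suc m))
last-downFrom zero    = here
last-downFrom (suc m) = there (last-downFrom m)

-- Injectivity is asked only on `P` because `even` and `odd` reduce mod `q` and separate only
-- arguments below q/2.
map-Unique : ∀ {P : A → Set} (f : A → B) → (∀ {x y} → P x → P y → f x ≡ f y → x ≡ y) →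
             All P xs → Unique xs → Unique (map f xs)
map-Unique f inj []       []       = []
map-Unique f inj (p ∷ ps) (x≢ ∷ u) =
  All.map⁺ (All.zipWith (λ (q , x≢y) → x≢y ∘ inj p q) (ps , x≢)) ∷ map-Unique f inj ps u

-- The successor relation of the first cycle of b, with k standing for the index 2k;
-- the second cycle runs the other way, with k standing for 2k+1.
data Step (m : ℕ) : ℕ → ℕ → Set where
  down   : ∀ {k} → suc k < suc m → Step m (suc k) k
  out    : Step m 0 (suc m + 0)
  up     : ∀ {k} → suc k < suc m → Step m (suc m + k) (suc m + suc k)
  return : Step m (suc m + m) m

module _ (m : ℕ) where

  ascending descending : List ℕ
  descending = downFrom (suc m) ++ map (suc m +_) (upTo (suc m))
  ascending  = upTo (suc m) ++ map (suc m +_) (downFrom (suc m))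

  step-descending : Step m x y → CyclicallyAdjacent x y descending
  step-descending (down p) = adjacent (adjacent-++ˡ (adjacent-downFrom _ p))
  step-descending out      = adjacent (adjacent-join (last-downFrom m))
  step-descending (up p)   = adjacent (adjacent-++ʳ (downFrom (suc m)) (adjacent-map _ (adjacent-upTo p)))
  step-descending return   = wrap (last-++ʳ (downFrom (suc m)) (last-map _ (last-applyUpTo id m)))

  -- That one relation describes both cycles, in opposite directions, is the source of bab = a: b
  -- moves even indices along a step and odd ones back along it, while a exchanges 2k with 2k+1.
  step-ascending : Step m x y → CyclicallyAdjacent y x ascending
  step-ascending (down p) = adjacent (adjacent-++ˡ (adjacent-upTo p))
  step-ascending out      = wrap (last-++ʳ (upTo (suc m)) (last-map _ (last-downFrom m)))
  step-ascending (up p)   = adjacent (adjacent-++ʳ (upTo (suc m)) (adjacent-map _ (adjacent-downFrom _ p)))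
  step-ascending return   = adjacent (adjacent-join (last-applyUpTo id m))

  halves : ∀ k → k < suc m + suc m → k < suc m ⊎ ∃ λ i → i < suc m × k ≡ suc m + i
  halves k k<2m with k <? suc m
  ... | yes k<m = inj₁ k<m
  ... | no  k≮m = inj₂ (k ∸ suc m , +-cancelˡ-< (suc m) _ _ (subst (_< suc m + suc m) eq k<2m) , eq)
    where eq = sym (m+[n∸m]≡n (≮⇒≥ k≮m))

  step-from : ∀ k → k < suc m + suc m → ∃ (Step m k)
  step-from k k<2m with halves k k<2m
  step-from zero    _ | inj₁ _ = _ , out
  step-from (suc k) _ | inj₁ k<m = _ , down k<m
  step-from k _ | inj₂ (i , i<m , refl) with m≤n⇒m<n∨m≡n i<m
  ... | inj₁ i+1<m = _ , up i+1<m
  ... | inj₂ refl  = _ , return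

  -- Predecessors are needed too, since b sends odd indices to them.
  step-to : ∀ k → k < suc m + suc m → ∃ λ l → Step m l k
  step-to k k<2m with halves k k<2m
  step-to k _ | inj₂ (zero , i<m , refl) = _ , out
  step-to k _ | inj₂ (suc i , i<m , refl) = _ , up i<m
  step-to k _ | inj₁ k<m with m≤n⇒m<n∨m≡n k<m
  ... | inj₁ k+1<m = _ , down k+1<m
  ... | inj₂ refl  = _ , return

  all-bounded : ∀ {xs ys} → All (_< suc m) xs → All (_< suc m) ys →
                All (_< suc m + suc m) (xs ++ map (suc m +_) ys)
  all-bounded ps qs = All.++⁺ (All.map (λ p → ≤-trans p (m≤m+n _ _)) ps)
                              (All.map⁺ (All.map (+-monoʳ-< (suc m)) qs))

  unique-halves : ∀ {xs ys} → All (_< suc m) xs → Unique xs → Unique ys →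
                  Unique (xs ++ map (suc m +_) ys)
  unique-halves {xs} {ys} ps u v = Unique.++⁺ u (Unique.map⁺ (+-cancelˡ-≡ (suc m) _ _) v)
    λ (p , q) → let (i , _ , eq) = ∈-map⁻ (suc m +_) {xs = ys} q in
      <⇒≱ (All.lookup ps p) (≤-trans (m≤m+n _ _) (≤-reflexive (sym eq)))

  all-downFrom : ∀ k → All (_< k) (downFrom k)
  all-downFrom k = All.applyDownFrom⁺₁ id k id

  all-descending : All (_< suc m + suc m) descending
  all-descending = all-bounded (all-downFrom _) (All.all-upTo _)

  all-ascending : All (_< suc m + suc m) ascending
  all-ascending = all-bounded (All.all-upTo _) (all-downFrom _)

  unique-descending : Unique descending
  unique-descending = unique-halves (all-downFrom _) (Unique.downFrom⁺ _) (Unique.upTo⁺ _)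

  unique-ascending : Unique ascending
  unique-ascending = unique-halves (All.all-upTo _) (Unique.upTo⁺ _) (Unique.downFrom⁺ _)

  cyclicallyAdjacent⇒∈ : CyclicallyAdjacent x y xs → x ∈ xs × y ∈ xs
  cyclicallyAdjacent⇒∈ (adjacent p) = adjacent⇒∈ˡ p , adjacent⇒∈ p
  cyclicallyAdjacent⇒∈ (wrap p)     = last⇒∈ p , here refl

  step-source : Step m x y → x < suc m + suc m
  step-source s = All.lookup all-descending (proj₁ (cyclicallyAdjacent⇒∈ (step-descending s)))

  step-target : Step m x y → y < suc m + suc m
  step-target s = All.lookup all-descending (proj₂ (cyclicallyAdjacent⇒∈ (step-descending s)))

-- The permutations a and b on even and odd indices

module _ (q : ℕ) .{{_ : NonZero q}} (m : ℕ) (q≡4m : q ≡ 4 * suc m) where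

  private
    M N : ℕ
    M = suc m
    N = M + M

    q≡2N : q ≡ 2 * N
    q≡2N = trans q≡4m (solve 1 (λ x → con 4 :* x := con 2 :* (x :+ x)) refl M)
      where open +-*-Solver

    q/4≡M : q / 4 ≡ M
    q/4≡M = trans (cong (_/ 4) (trans q≡4m (*-comm 4 M))) (m*n/n≡m M 4)

    q/2≡N : q / 2 ≡ N
    q/2≡N = trans (cong (_/ 2) (trans q≡2N (*-comm 2 N))) (m*n/n≡m N 2)

  even odd : ℕ → Fin q
  even k = (2 * k) mod q
  odd  k = (2 * k + 1) mod q

  private
    toℕ-mod : ∀ {k} → k < q → toℕ (k mod q) ≡ k
    toℕ-mod {k} k<q = trans (toℕ-fromℕ< (m%n<n k q)) (m<n⇒m%n≡m k<q)

    2k+1<q : ∀ {k} → k < N → 2 * k + 1 < q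
    2k+1<q {k} k<N = subst (2 * k + 1 <_) (sym q≡2N) (begin-strict
      2 * k + 1 <⟨ +-monoʳ-< (2 * k) (s≤s (s≤s z≤n)) ⟩
      2 * k + 2 ≡⟨ solve 1 (λ x → con 2 :* x :+ con 2 := con 2 :* (con 1 :+ x)) refl k ⟩
      2 * suc k ≤⟨ *-monoʳ-≤ 2 k<N ⟩
      2 * N     ∎)
      where open ≤-Reasoning
            open +-*-Solver

    2k<q : ∀ {k} → k < N → 2 * k < q
    2k<q k<N = ≤-<-trans (m≤m+n _ 1) (2k+1<q k<N)

    toℕ-even : ∀ {k} → k < N → toℕ (even k) ≡ 2 * k
    toℕ-even = toℕ-mod ∘ 2k<q

    toℕ-odd : ∀ {k} → k < N → toℕ (odd k) ≡ 2 * k + 1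
    toℕ-odd = toℕ-mod ∘ 2k+1<q

  even-injective : ∀ {k l} → k < N → l < N → even k ≡ even l → k ≡ l
  even-injective k<N l<N eq = *-cancelˡ-≡ _ _ 2
    (trans (sym (toℕ-even k<N)) (trans (cong toℕ eq) (toℕ-even l<N)))

  odd-injective : ∀ {k l} → k < N → l < N → odd k ≡ odd l → k ≡ l
  odd-injective k<N l<N eq = *-cancelˡ-≡ _ _ 2 (+-cancelʳ-≡ 1 _ _
    (trans (sym (toℕ-odd k<N)) (trans (cong toℕ eq) (toℕ-odd l<N))))

  even≢odd-index : ∀ {k l} → k < N → l < N → even k ≢ odd l
  even≢odd-index {k} {l} k<N l<N eq = even≢odd k l (begin
    2 * k          ≡⟨ toℕ-even k<N ⟨
    toℕ (even k)   ≡⟨ cong toℕ eq ⟩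
    toℕ (odd l)    ≡⟨ toℕ-odd l<N ⟩
    2 * l + 1      ≡⟨ +-comm (2 * l) 1 ⟩
    suc (2 * l)    ∎)
    where open ≡-Reasoning

  data EvenOrOdd : Fin q → Set where
    isEven : ∀ {k} → k < N → EvenOrOdd (even k)
    isOdd  : ∀ {k} → k < N → EvenOrOdd (odd k)

  evenOrOdd : ∀ x → EvenOrOdd x
  evenOrOdd x with toℕ x % 2 | m%n<n (toℕ x) 2 | m≡m%n+[m/n]*n (toℕ x) 2
  ... | 0 | _ | eq = subst EvenOrOdd (toℕ-injective (trans (toℕ-even k<N) (sym eq′))) (isEven k<N)
    where
    eq′ : toℕ x ≡ 2 * (toℕ x / 2)
    eq′ = trans eq (*-comm (toℕ x / 2) 2)
    k<N : toℕ x / 2 < N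
    k<N = *-cancelˡ-< 2 _ _ (subst₂ _<_ eq′ q≡2N (toℕ<n x))
  ... | 1 | _ | eq = subst EvenOrOdd (toℕ-injective (trans (toℕ-odd k<N) (sym eq′))) (isOdd k<N)
    where
    eq′ : toℕ x ≡ 2 * (toℕ x / 2) + 1
    eq′ = trans eq (trans (cong suc (*-comm (toℕ x / 2) 2)) (+-comm 1 _))
    k<N : toℕ x / 2 < N
    k<N = *-cancelˡ-< 2 _ _ (≤-<-trans (m≤m+n _ 1) (subst₂ _<_ eq′ q≡2N (toℕ<n x)))
  ... | suc (suc _) | s≤s (s≤s ()) | _

  private
    pair : ℕ → List (Fin q)
    pair k = even k ∷ odd k ∷ []

    even∉pair : ∀ {k l} → k < N → l < N → k ≢ l → even k ∉ pair l
    even∉pair k<N l<N k≢l (here eq)         = k≢l (even-injective k<N l<N eq)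
    even∉pair k<N l<N k≢l (there (here eq)) = even≢odd-index k<N l<N eq

    odd∉pair : ∀ {k l} → k < N → l < N → k ≢ l → odd k ∉ pair l
    odd∉pair k<N l<N k≢l (here eq)         = even≢odd-index l<N k<N (sym eq)
    odd∉pair k<N l<N k≢l (there (here eq)) = k≢l (odd-injective k<N l<N eq)

    pairs-outside : ∀ {x} (ks : List ℕ) → All (λ l → x ∉ pair l) ks → to (cycles (map pair ks)) x ≡ x
    pairs-outside []       []       = refl
    pairs-outside (k ∷ ks) (p ∷ ps) =
      trans (cong (to (cycle (pair k))) (pairs-outside ks ps)) (cycle-outside (pair k) p)

    -- The transpositions have disjoint supports, so those standing before or after `pair k` in the
    -- list fix both of its entries.
    pairs-swap : ∀ {ks k} → All (_< N) ks → Unique ks → k ∈ ks →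
                 to (cycles (map pair ks)) (even k) ≡ odd k ×
                 to (cycles (map pair ks)) (odd k) ≡ even k
    pairs-swap {k ∷ ks} (k<N ∷ ps) (k≢ ∷ u) (here refl) =
      trans (cong (to (cycle (pair k))) (pairs-outside ks
              (All.zipWith (λ (l<N , k≢l) → even∉pair k<N l<N k≢l) (ps , k≢))))
            (transpose-matchˡ (even k) (odd k)) ,
      trans (cong (to (cycle (pair k))) (pairs-outside ks
              (All.zipWith (λ (l<N , k≢l) → odd∉pair k<N l<N k≢l) (ps , k≢))))
            (transpose-matchʳ (even k) (odd k))
    pairs-swap {l ∷ ks} {k} (l<N ∷ ps) (l≢ ∷ u) (there k∈) =
      let k<N = All.lookup ps k∈
          k≢l = λ eq → All.lookup l≢ k∈ (sym eq)
          (e , o) = pairs-swap ps u k∈ in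
      trans (cong (to (cycle (pair l))) e) (cycle-outside (pair l) (odd∉pair k<N l<N k≢l)) ,
      trans (cong (to (cycle (pair l))) o) (cycle-outside (pair l) (even∉pair k<N l<N k≢l))

    aIndex-swap : ∀ {k} → k < N → to (aIndex q) (even k) ≡ odd k × to (aIndex q) (odd k) ≡ even k
    aIndex-swap k<N rewrite q/2≡N = pairs-swap (All.all-upTo N) (Unique.upTo⁺ N) (∈-upTo⁺ k<N)

    -- Since q/2 = M + M, the entries q/2 + 2k and q/2 + 2k + 1 are the images of M + k under `even`
    -- and `odd`, so halving turns both cycles into the lists that `Step` describes.
    bIndex-cycles : bIndex q ≡ cycles (map even (descending m) ∷ map odd (ascending m) ∷ [])
    bIndex-cycles rewrite q/4≡M | q/2≡N = cong₂ (λ xs ys → cycles (xs ∷ ys ∷ []))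
      (trans (cong (indices q) (trans
        (cong (map (2 *_) (downFrom M) ++_) (trans
          (map-cong (λ k → solve 2 (λ x y → x :+ x :+ con 2 :* y := con 2 :* (x :+ y)) refl M k) (upTo M))
          (map-∘ (upTo M))))
        (sym (map-++ (2 *_) (downFrom M) _))))
        (sym (map-∘ (descending m))))
      (trans (cong (indices q) (trans
        (cong (map (λ k → 2 * k + 1) (upTo M) ++_) (trans
          (map-cong (λ k → solve 2 (λ x y → x :+ x :+ con 2 :* y :+ con 1 := con 2 :* (x :+ y) :+ con 1) refl M k) (downFrom M))
          (map-∘ (downFrom M))))
        (sym (map-++ (λ k → 2 * k + 1) (upTo M) _))))
        (sym (map-∘ (ascending m))))
      where open +-*-Solver

    even∉odds : ∀ {k} → k < N → even k ∉ map odd (ascending m)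
    even∉odds k<N p = let (l , l∈ , eq) = ∈-map⁻ odd p in
      even≢odd-index k<N (All.lookup (all-ascending m) l∈) eq

    odd∉evens : ∀ {k} → k < N → odd k ∉ map even (descending m)
    odd∉evens k<N p = let (l , l∈ , eq) = ∈-map⁻ even p in
      even≢odd-index (All.lookup (all-descending m) l∈) k<N (sym eq)

    bIndex-even : ∀ {k l} → k < N → Step m k l → to (bIndex q) (even k) ≡ even l
    bIndex-even {k} k<N s = trans (cong (λ π → to π (even k)) bIndex-cycles) (trans
      (cong (to (cycle (map even (descending m)))) (cycle-outside (map odd (ascending m)) (even∉odds k<N)))
      (cycle-cyclicallyAdjacent
        (map-Unique even even-injective (all-descending m) (unique-descending m))
        (cyclicallyAdjacent-map even (step-descending m s))))

    bIndex-odd : ∀ {k l} → k < N → Step m k l → to (bIndex q) (odd l) ≡ odd k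
    bIndex-odd {l = l} k<N s = trans (cong (λ π → to π (odd l)) bIndex-cycles) (trans
      (cong (to (cycle (map even (descending m)))) (cycle-cyclicallyAdjacent
        (map-Unique odd odd-injective (all-ascending m) (unique-ascending m))
        (cyclicallyAdjacent-map odd (step-ascending m s))))
      (cycle-outside (map even (descending m)) (odd∉evens k<N)))

  aIndex-involutive : ∀ x → to (aIndex q) (to (aIndex q) x) ≡ x
  aIndex-involutive x with evenOrOdd x
  ... | isEven k<N = let (e , o) = aIndex-swap k<N in trans (cong (to (aIndex q)) e) o
  ... | isOdd  k<N = let (e , o) = aIndex-swap k<N in trans (cong (to (aIndex q)) o) e

  bIndex-aIndex-bIndex : ∀ x →
    to (bIndex q) (to (aIndex q) (to (bIndex q) x)) ≡ to (aIndex q) x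
  bIndex-aIndex-bIndex x with evenOrOdd x
  ... | isEven {k} k<N = let (l , s) = step-from m k k<N; l<N = step-target m s in begin
    b (a (b (even k))) ≡⟨ cong (b ∘ a) (bIndex-even k<N s) ⟩
    b (a (even l))     ≡⟨ cong b (proj₁ (aIndex-swap l<N)) ⟩
    b (odd l)          ≡⟨ bIndex-odd k<N s ⟩
    odd k              ≡⟨ proj₁ (aIndex-swap k<N) ⟨
    a (even k)         ∎
    where open ≡-Reasoning
          a b : Fin q → Fin q
          a = to (aIndex q)
          b = to (bIndex q)
  ... | isOdd {l} l<N = let (k , s) = step-to m l l<N; k<N = step-source m s in begin
    b (a (b (odd l)))  ≡⟨ cong (b ∘ a) (bIndex-odd k<N s) ⟩
    b (a (odd k))      ≡⟨ cong b (proj₂ (aIndex-swap k<N)) ⟩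
    b (even k)         ≡⟨ bIndex-even k<N s ⟩
    even l             ≡⟨ proj₂ (aIndex-swap l<N) ⟨
    a (odd l)          ∎
    where open ≡-Reasoning
          a b : Fin q → Fin q
          a = to (aIndex q)
          b = to (bIndex q)

-- The dihedral group

permutation-injective : (π : Permutation′ n) → Injective _≡_ _≡_ (to π)
permutation-injective π = Injection.injective (Inverse⇒Injection π)

^ₛ-+ : (π : Permutation′ n) (i j : ℕ) (x : Fin n) → to (π ^ₛ (i + j)) x ≡ to (π ^ₛ i) (to (π ^ₛ j) x)
^ₛ-+ π zero    j x = refl
^ₛ-+ π (suc i) j x = cong (to π) (^ₛ-+ π i j x)

^ₛ-suc : (π : Permutation′ n) (i : ℕ) (x : Fin n) → to (π ^ₛ suc i) x ≡ to (π ^ₛ i) (to π x)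
^ₛ-suc π zero    x = refl
^ₛ-suc π (suc i) x = cong (to π) (^ₛ-suc π i x)

opposite-injective : ∀ {n} {i j : Fin n} → opposite i ≡ opposite j → i ≡ j
opposite-injective {i = i} {j} eq =
  trans (sym (opposite-involutive i)) (trans (cong opposite eq) (opposite-involutive j))

module Dihedral
  {q : ℕ} (m : ℕ) (2<N : 2 < 2 * suc m) (a b : Permutation′ q)
  (a-involutive : ∀ x → to a (to a x) ≡ x)
  (bab≡a : ∀ x → to b (to a (to b x)) ≡ to a x)
  where

  M N : ℕ
  M = suc m
  N = 2 * M

  element : Fin N × Fin 2 → Permutation′ q
  element (s , e) = (b ^ₛ toℕ s) ∘ₛ (a ^ₛ toℕ e)

  half : Fin 2 → Fin M → Fin N
  half = combine

  half-injective : ∀ i j k l → half i j ≡ half k l → i ≡ k × j ≡ l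
  half-injective = combine-injective

  -- θ of b^(Mh+k) a^e; half 0F k and half 1F (opposite k) are k and N - 1 - k.
  θ : Fin 2 → Fin M → Fin 2 → Fin N × Fin 2
  θ h  k 0F = half 0F k , h
  θ 0F k 1F = half 1F (opposite k) , 1F
  θ 1F k 1F = half 1F (opposite k) , 0F

  -- The half containing the rotation exponent recovers `e`, the place within that half recovers
  -- `k`, and the remaining bit recovers `h`, flipped when `e` is 1.
  θ-injective : ∀ h k e h′ k′ e′ → θ h k e ≡ θ h′ k′ e′ → h ≡ h′ × k ≡ k′ × e ≡ e′
  θ-injective h k 0F h′ k′ 0F eq =
    cong proj₂ eq , proj₂ (half-injective 0F k 0F k′ (cong proj₁ eq)) , refl
  θ-injective h k 0F 0F k′ 1F eq =
    contradiction (proj₁ (half-injective 0F k 1F (opposite k′) (cong proj₁ eq))) λ ()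
  θ-injective h k 0F 1F k′ 1F eq =
    contradiction (proj₁ (half-injective 0F k 1F (opposite k′) (cong proj₁ eq))) λ ()
  θ-injective 0F k 1F h′ k′ 0F eq =
    contradiction (proj₁ (half-injective 1F (opposite k) 0F k′ (cong proj₁ eq))) λ ()
  θ-injective 1F k 1F h′ k′ 0F eq =
    contradiction (proj₁ (half-injective 1F (opposite k) 0F k′ (cong proj₁ eq))) λ ()
  θ-injective 0F k 1F 0F k′ 1F eq =
    refl , opposite-injective (proj₂ (half-injective 1F _ 1F _ (cong proj₁ eq))) , refl
  θ-injective 1F k 1F 1F k′ 1F eq =
    refl , opposite-injective (proj₂ (half-injective 1F _ 1F _ (cong proj₁ eq))) , refl
  θ-injective 0F k 1F 1F k′ 1F eq = contradiction (cong proj₂ eq) λ ()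
  θ-injective 1F k 1F 0F k′ 1F eq = contradiction (cong proj₂ eq) λ ()

  module _
    (regular : ∀ x {c d} → to (element c) x ≡ to (element d) x → c ≡ d)
    (transitive : ∀ x y → ∃ λ c → to (element c) x ≡ y)
    where

    regular′ : ∀ x {s t e f} → s < N → t < N →
               to (b ^ₛ s) (to (a ^ₛ toℕ {2} e) x) ≡ to (b ^ₛ t) (to (a ^ₛ toℕ {2} f) x) →
               s ≡ t × e ≡ f
    regular′ x {e = e} {f} s<N t<N eq =
      fromℕ<-injective _ _ s<N t<N (cong proj₁ same) , cong proj₂ same
      where
      same : (fromℕ< s<N , e) ≡ (fromℕ< t<N , f)
      same = regular x (trans
        (cong (λ s → to (b ^ₛ s) (to (a ^ₛ toℕ e) x)) (toℕ-fromℕ< s<N))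
        (trans eq (cong (λ t → to (b ^ₛ t) (to (a ^ₛ toℕ f) x)) (sym (toℕ-fromℕ< t<N)))))

    0<N : 0 < N
    0<N = s≤s z≤n

    -- Transitivity writes bᴺ x as bˢ aᵉ x. If s > 0, cancelling bˢ gives bᴺ⁻ˢ x = aᵉ x with 0 < N -
    -- s < N, against regularity; s = 0 leaves the two stated values.
    order-or-flip : ∀ x → to (b ^ₛ N) x ≡ x ⊎ to (b ^ₛ N) x ≡ to a x
    order-or-flip x with transitive x (to (b ^ₛ N) x)
    ... | (zero , 0F) , eq = inj₁ (sym eq)
    ... | (zero , 1F) , eq = inj₂ (sym eq)
    ... | (s@(suc s′) , e) , eq = contradiction
      (proj₁ (regular′ x {N ∸ toℕ s} {0} {0F} {e} (∸-monoʳ-< z<s (<⇒≤ (toℕ<n s))) 0<N cancelled))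
      (>⇒≢ (m<n⇒0<n∸m (toℕ<n s)))
      where
      cancelled : to (b ^ₛ (N ∸ toℕ s)) x ≡ to (a ^ₛ toℕ e) x
      cancelled = permutation-injective (b ^ₛ toℕ s) (trans
        (sym (^ₛ-+ b (toℕ s) (N ∸ toℕ s) x))
        (trans (cong (λ t → to (b ^ₛ t) x) (m+[n∸m]≡n (<⇒≤ (toℕ<n s)))) (sym eq)))

    -- If bᴺ and a agreed at x, then comparing bᴺ(b x) = b(a x) with the two possible
    -- values of bᴺ at b x would give a fixed point of a or a coincidence of b² with a.
    order : ∀ x → to (b ^ₛ N) x ≡ x
    order x with order-or-flip x
    ... | inj₁ eq = eq
    ... | inj₂ eq with order-or-flip (to b x)
    ...   | inj₁ eq′ = contradiction
      (proj₂ (regular′ x {0} {0} {1F} {0F} 0<N 0<N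
        (permutation-injective b (trans (sym (trans (sym (^ₛ-suc b N x)) (cong (to b) eq))) eq′))))
      λ ()
    ...   | inj₂ eq′ = contradiction
      (proj₁ (regular′ (to a x) {2} {0} {0F} {0F} 2<N 0<N (trans
        (cong (to b) (trans (sym (trans (sym (^ₛ-suc b N x)) (cong (to b) eq))) eq′)) (bab≡a x))))
      λ ()

    ^ₛ-* : ∀ k x → to (b ^ₛ (k * N)) x ≡ x
    ^ₛ-* zero    x = refl
    ^ₛ-* (suc k) x = trans (^ₛ-+ b N (k * N) x) (trans (order _) (^ₛ-* k x))

    ^ₛ-% : ∀ t x → to (b ^ₛ t) x ≡ to (b ^ₛ (t % N)) x
    ^ₛ-% t x = begin
      to (b ^ₛ t) x                                 ≡⟨ cong (λ s → to (b ^ₛ s) x) (m≡m%n+[m/n]*n t N) ⟩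
      to (b ^ₛ (t % N + t / N * N)) x               ≡⟨ ^ₛ-+ b (t % N) (t / N * N) x ⟩
      to (b ^ₛ (t % N)) (to (b ^ₛ (t / N * N)) x)   ≡⟨ cong (to (b ^ₛ (t % N))) (^ₛ-* (t / N) x) ⟩
      to (b ^ₛ (t % N)) x                           ∎
      where open ≡-Reasoning

    -- By `order`, exponents may be reduced modulo N, which brings them into the range where
    -- regularity applies.
    same-coset : ∀ x s t {e f} →
      to (b ^ₛ s) (to (a ^ₛ toℕ {2} e) x) ≡ to (b ^ₛ t) (to (a ^ₛ toℕ {2} f) x) → e ≡ f
    same-coset x s t eq = proj₂ (regular′ x (m%n<n s N) (m%n<n t N)
      (trans (sym (^ₛ-% s _)) (trans eq (^ₛ-% t _))))

    bab-^ : ∀ k x → to (b ^ₛ k) (to a (to (b ^ₛ k) x)) ≡ to a x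
    bab-^ zero    x = refl
    bab-^ (suc k) x = begin
      to b (to (b ^ₛ k) (to a (to (b ^ₛ suc k) x)))     ≡⟨ cong (to b ∘ to (b ^ₛ k) ∘ to a) (^ₛ-suc b k x) ⟩
      to b (to (b ^ₛ k) (to a (to (b ^ₛ k) (to b x))))  ≡⟨ cong (to b) (bab-^ k (to b x)) ⟩
      to b (to a (to b x))                              ≡⟨ bab≡a x ⟩
      to a x                                            ∎
      where open ≡-Reasoning

    -- This is a bˡ = b⁻ˡ a with the inverse written as the complementary power: bᵏ a bᵏ replaces a,
    -- and bᵏ⁺ˡ = 1.
    a-^ : ∀ k l → k + l ≡ N → ∀ x → to a (to (b ^ₛ l) x) ≡ to (b ^ₛ k) (to a x)
    a-^ k l k+l≡N x = begin
      to a (to (b ^ₛ l) x)                                ≡⟨ bab-^ k _ ⟨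
      to (b ^ₛ k) (to a (to (b ^ₛ k) (to (b ^ₛ l) x)))    ≡⟨ cong (to (b ^ₛ k) ∘ to a) (^ₛ-+ b k l x) ⟨
      to (b ^ₛ k) (to a (to (b ^ₛ (k + l)) x))            ≡⟨ cong (λ t → to (b ^ₛ k) (to a (to (b ^ₛ t) x))) k+l≡N ⟩
      to (b ^ₛ k) (to a (to (b ^ₛ N) x))                  ≡⟨ cong (to (b ^ₛ k) ∘ to a) (order x) ⟩
      to (b ^ₛ k) (to a x)                                ∎
      where open ≡-Reasoning

    private
      -- `combine k e` encodes 2k + e, so the pairs (k, e) run exactly once through the exponents
      -- below N.
      double : ∀ k → toℕ {M} k + toℕ (half 0F k) ≡ toℕ (combine {n = 2} k 0F)
      double k = begin
        toℕ k + toℕ (half 0F k) ≡⟨ cong (toℕ k +_) (toℕ-combine {2} 0F k) ⟩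
        toℕ k + (M * 0 + toℕ k)        ≡⟨ solve 2 (λ x y → x :+ (y :* con 0 :+ x) := con 2 :* x :+ con 0) refl (toℕ k) M ⟩
        2 * toℕ k + 0                  ≡⟨ toℕ-combine {n = 2} k 0F ⟨
        toℕ (combine k 0F)             ∎
        where open ≡-Reasoning
              open +-*-Solver

      complement : ∀ k → suc (toℕ {M} k) + toℕ (half 1F (opposite k)) ≡ N
      complement k = begin
        suc (toℕ k) + toℕ (half 1F (opposite k))   ≡⟨ cong (suc (toℕ k) +_) (toℕ-combine {2} 1F (opposite k)) ⟩
        suc (toℕ k) + (M * 1 + toℕ (opposite k))          ≡⟨ cong (λ t → suc (toℕ k) + (M * 1 + t)) (opposite-prop k) ⟩
        suc (toℕ k) + (M * 1 + (M ∸ suc (toℕ k)))         ≡⟨ solve 3 (λ x y z → x :+ (y :* con 1 :+ z) := y :+ ((x :+ z) :+ con 0)) refl (suc (toℕ k)) M (M ∸ suc (toℕ k)) ⟩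
        M + ((suc (toℕ k) + (M ∸ suc (toℕ k))) + 0)       ≡⟨ cong (λ t → M + (t + 0)) (m+[n∸m]≡n (toℕ<n k)) ⟩
        N                                                 ∎
        where open ≡-Reasoning
              open +-*-Solver

      odd-double : ∀ k → toℕ {M} k + suc (toℕ k) ≡ toℕ (combine {n = 2} k 1F)
      odd-double k = trans
        (solve 1 (λ x → x :+ (con 1 :+ x) := con 2 :* x :+ con 1) refl (toℕ k))
        (sym (toℕ-combine {n = 2} k 1F))
        where open +-*-Solver

      split : ∀ h k x → to (b ^ₛ toℕ (half h k)) x ≡ to (b ^ₛ (M * toℕ h)) (to (b ^ₛ toℕ k) x)
      split h k x = trans (cong (λ t → to (b ^ₛ t) x) (toℕ-combine h k)) (^ₛ-+ b (M * toℕ h) (toℕ k) x)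

      fuse : ∀ i j {t} x → i + j ≡ t → to (b ^ₛ i) (to (b ^ₛ j) x) ≡ to (b ^ₛ t) x
      fuse i j x refl = sym (^ₛ-+ b i j x)

    -- For e = 1, moving a past b⁻¹⁻ᵏ produces bᵏ⁺¹, whence the exponent k + (k + 1); what is left
    -- of the reflections is a² = 1 when h = 0 and a when h = 1. The factor with exponent Mh stays
    -- separate so that it can be cancelled without any reduction modulo N.
    product : ∀ h k e w →
      to (element (half h k , e)) (to (element (θ h k e)) w) ≡
      to (b ^ₛ (M * toℕ h)) (to (b ^ₛ toℕ (combine k e)) (to (a ^ₛ toℕ h) w))
    product h k 0F w = trans (split h k _)
      (cong (to (b ^ₛ (M * toℕ h))) (fuse (toℕ k) (toℕ (half 0F k)) _ (double k)))
    product 0F k 1F w = trans (split 0F k _) (cong (to (b ^ₛ (M * 0))) (trans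
      (cong (to (b ^ₛ toℕ k)) (trans
        (a-^ (suc (toℕ k)) (toℕ (half 1F (opposite k))) (complement k) _)
        (cong (to (b ^ₛ suc (toℕ k))) (a-involutive w))))
      (fuse (toℕ k) (suc (toℕ k)) _ (odd-double k))))
    product 1F k 1F w = trans (split 1F k _) (cong (to (b ^ₛ (M * 1))) (trans
      (cong (to (b ^ₛ toℕ k)) (a-^ (suc (toℕ k)) (toℕ (half 1F (opposite k))) (complement k) _))
      (fuse (toℕ k) (suc (toℕ k)) _ (odd-double k))))

    -- The coset of the product determines h. The common power with exponent Mh then cancels, and
    -- the exponents 2k + e, being below N, are compared by regularity.
    product-injective : ∀ h k e h′ k′ e′ w →
      to (element (half h k , e)) (to (element (θ h k e)) w) ≡
      to (element (half h′ k′ , e′)) (to (element (θ h′ k′ e′)) w) →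
      h ≡ h′ × k ≡ k′ × e ≡ e′
    product-injective h k e h′ k′ e′ w eq with h≡h′
      where
      eq′ = trans (sym (product h k e w)) (trans eq (product h′ k′ e′ w))
      h≡h′ : h ≡ h′
      h≡h′ = same-coset w (M * toℕ h + toℕ (combine k e)) (M * toℕ h′ + toℕ (combine k′ e′))
        (trans (^ₛ-+ b (M * toℕ h) (toℕ (combine k e)) _)
          (trans eq′ (sym (^ₛ-+ b (M * toℕ h′) (toℕ (combine k′ e′)) _))))
    ... | refl = refl , combine-injective k e k′ e′ (toℕ-injective (proj₁
      (regular′ w {e = h} {h} (bound k e) (bound k′ e′) (permutation-injective (b ^ₛ (M * toℕ h)) eq″))))
      where
      eq″ = trans (sym (product h k e w)) (trans eq (product h′ k′ e′ w))
      bound : ∀ k e → toℕ (combine {M} {2} k e) < N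
      bound k e = subst (toℕ (combine k e) <_) (*-comm M 2) (toℕ<n _)

-- The tuple as a regular dihedral action, and the companion

module _ {c ℓ₁ ℓ₂} (F : HeytingField c ℓ₁ ℓ₂) {q} (m : ℕ)
  (2<N : 2 < 2 * suc m) (q≡4M : q ≡ 4 * suc m) (a b : Permutation′ q)
  (a-involutive : ∀ x → to a (to a x) ≡ x)
  (bab≡a : ∀ x → to b (to a (to b x)) ≡ to a x)
  (enum : Enumeration F q) (f : Polynomial F q) (f-lpp : IsLPP F f)
  (β : Fin q → Sym (HeytingField.setoid F)) (f-tuple : IsTupleOf F enum f β)
  (β-dihedral : ∀ i → ∃₂ λ j e → j < q / 2 × e < 2 ×
                β i ≋ (onField F enum b ^ₛ j) ∘ₛ (onField F enum a ^ₛ e))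
  where

  open HeytingField F using (_≈_) renaming (refl to ≈-refl; sym to ≈-sym; trans to ≈-trans)
  open FiniteField F
  open IsTupleOf f-tuple
  open Dihedral m 2<N a b a-involutive bab≡a

  private
    N*2≡q : N * 2 ≡ q
    N*2≡q = trans (solve 1 (λ x → con 2 :* x :* con 2 := con 4 :* x) refl (suc m)) (sym q≡4M)
      where open +-*-Solver

    q/2≡N : q / 2 ≡ N
    q/2≡N = trans (cong (_/ 2) (sym N*2≡q)) (m*n/n≡m N 2)

    decode : ∀ i → ∃ λ c → ∀ x → to (β i) (to enum x) ≈ to enum (to (element c) x)
    decode i =
      let (j , e , j<q/2 , e<2 , β≋) = β-dihedral i
          j<N = subst (j <_) q/2≡N j<q/2
      in (fromℕ< j<N , fromℕ< e<2) , λ x → ≈-trans (β≋ (to enum x))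
        (≈-trans (^ₛ∘^ₛ-onField enum b a j e x) (Inverse.to-cong enum
          (cong₂ (λ s t → to ((b ^ₛ s) ∘ₛ (a ^ₛ t)) x)
            (sym (Fin.toℕ-fromℕ< j<N)) (sym (Fin.toℕ-fromℕ< e<2)))))

    code : Fin q → Fin N × Fin 2
    code i = proj₁ (decode i)

    β≈ : ∀ i x → to (β i) (to enum x) ≈ to enum (to (element (code i)) x)
    β≈ i = proj₂ (decode i)

    element-code-injective : ∀ x {i j} → to (element (code i)) x ≡ to (element (code j)) x → i ≡ j
    element-code-injective x {i} {j} eq = tuple-injective enum β isPermutationTuple (to enum x)
      (≈-trans (β≈ i x) (≈-trans (Inverse.to-cong enum eq) (≈-sym (β≈ j x))))

    code-injective : ∀ {i j} → code i ≡ code j → i ≡ j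
    code-injective {i} eq = element-code-injective i (cong (λ c → to (element c) i) eq)

    combine′ : Fin N × Fin 2 → Fin (N * 2)
    combine′ (s , e) = combine s e

    combine′-injective : ∀ {c d} → combine′ c ≡ combine′ d → c ≡ d
    combine′-injective {s , e} {t , f} eq =
      let (s≡t , e≡f) = Fin.combine-injective s e t f eq in cong₂ _,_ s≡t e≡f

    -- Pigeonhole with exactly 2N = q codes. As every bˢaᵉ thus occurs in the tuple,
    -- fixed-point-freeness of the tuple becomes regularity of the whole family `element`.
    code-surjective : ∀ c → ∃ λ i → code i ≡ c
    code-surjective c =
      let (i , eq) = injective⇒strictlySurjective {f = combine′ ∘ code} (≤-reflexive N*2≡q)
                       (code-injective ∘ combine′-injective) (combine′ c)
      in i , combine′-injective eq

    regular : ∀ x {c d} → to (element c) x ≡ to (element d) x → c ≡ d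
    regular x {c} {d} eq =
      let (i , i≡) = code-surjective c
          (j , j≡) = code-surjective d
      in trans (sym i≡) (trans (cong code (element-code-injective x (trans
           (cong (λ c → to (element c) x) i≡)
           (trans eq (cong (λ d → to (element d) x) (sym j≡)))))) j≡)

    -- The q entries take q different values at `x`, hence all of them.
    transitive : ∀ x y → ∃ λ c → to (element c) x ≡ y
    transitive x y =
      let (i , eq) = injective⇒strictlySurjective {f = λ i → to (element (code i)) x}
                       ≤-refl (element-code-injective x) y
      in code i , eq

    h : Fin q → Fin 2
    h i = proj₁ (remQuot {2} M (proj₁ (code i)))

    k : Fin q → Fin M
    k i = proj₂ (remQuot {2} M (proj₁ (code i)))

    e : Fin q → Fin 2
    e i = proj₂ (code i)

    recombine : ∀ i → (half (h i) (k i) , e i) ≡ code i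
    recombine i = cong (_, e i) (Fin.combine-remQuot {2} M (proj₁ (code i)))

    components-injective : ∀ {i j} → h i ≡ h j × k i ≡ k j × e i ≡ e j → i ≡ j
    components-injective {i} {j} (hh , kk , ee) = code-injective (trans (sym (recombine i))
      (trans (cong₂ _,_ (cong₂ half hh kk) ee) (recombine j)))

    partner : Fin q → Permutation′ q
    partner i = element (θ (h i) (k i) (e i))

  has-companion : HasCompanion F f
  has-companion = companion enum f f-lpp (λ i → to (element (code i))) partner
    (λ i x → ≈-trans (eval-cong f ≈-refl (≈-sym (β≈ i x))) (graph i (to enum x)))
    (λ w {i} {j} eq → components-injective
      (θ-injective (h i) (k i) (e i) (h j) (k j) (e j) (regular w eq)))
    (λ w {i} {j} eq → components-injective
      (product-injective regular transitive (h i) (k i) (e i) (h j) (k j) (e j) w (trans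
        (cong (λ c → to (element c) (to (partner i) w)) (recombine i))
        (trans eq (cong (λ c → to (element c) (to (partner j) w)) (sym (recombine j)))))))

2^r≡4M : ∀ {r} → 3 ≤ r → ∃ λ m → 2 < 2 * suc m × 2 ^ r ≡ 4 * suc m
-- With `r` now standing for the exponent less 3, M = 2 · 2^r is at least 2 and N at least 4; the
-- exponent 2 is then below N, as the proof of `order` requires.
2^r≡4M {suc (suc (suc r))} (s≤s (s≤s (s≤s _))) = pred (2 * 2 ^ r) ,
  subst (λ t → 2 < 2 * t) (sym M≡) (≤-trans (s≤s (s≤s (s≤s z≤n))) (*-monoʳ-≤ 2 (*-monoʳ-≤ 2 (m^n>0 2 r)))) ,
  trans (solve 1 (λ x → con 2 :* (con 2 :* (con 2 :* x)) := con 4 :* (con 2 :* x)) refl (2 ^ r))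
        (cong (4 *_) (sym M≡))
  where
  open +-*-Solver
  M≡ : suc (pred (2 * 2 ^ r)) ≡ 2 * 2 ^ r
  M≡ = suc-pred (2 * 2 ^ r) {{m^n≢0 2 (suc r)}}

theorem4p9 :
    ∀ {c ℓ₁ ℓ₂} (F : HeytingField c ℓ₁ ℓ₂) (r : ℕ) → 3 ≤ r →
    (enum : Enumeration F (2 ^ r)) (f : Polynomial F (2 ^ r)) → IsLPP F f →
    (β : Fin (2 ^ r) → Sym (HeytingField.setoid F)) → IsTupleOf F enum f β →
    ConsistsOf F β (InG₂ F r enum) →
    HasCompanion F f
theorem4p9 F r 3≤r enum f f-lpp β f-tuple β-G₂ =
  let (m , 2<N , q≡4M) = 2^r≡4M 3≤r
      instance q≢0 = m^n≢0 2 r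
  in has-companion F m 2<N q≡4M (aIndex (2 ^ r)) (bIndex (2 ^ r))
       (aIndex-involutive (2 ^ r) m q≡4M) (bIndex-aIndex-bIndex (2 ^ r) m q≡4M)
       enum f f-lpp β f-tuple (λ i → Equivalence.to (β-G₂ (β i)) (i , λ _ → HeytingField.refl F))
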